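{- Let $k$ be a natural number and let $P_k(x)$ be the characteristic polynomial of the minimal homogeneous linear recurrence with integer coefficients satisfied by the sequence $\{S(\sigma_{n,k})\}_{n\in\mathbb{N}}$, where $S(\sigma_{n,k})=\sum_{j=0}^n(-1)^{\binom{j}{k}}\binom{n}{j}$. Let $\bar{k}=2\lfloor k/2\rfloor+1$, with binary expansion $\bar{k}=1+2^{a_1}+2^{a_2}+\cdots+2^{a_l}$, $1\le a_1<\cdots<a_l$, so that $a_l=\lfloor\log_2(\bar k)\rfloor$. Then $$P_k(x)=(x-2)^{\epsilon(k)}\prod_{j=1}^l\Phi_{2^{a_j+1}}(x-1),$$ where $\epsilon(k)=0$ if $k$ is a power of $2$ and $\epsilon(k)=1$ otherwise. In particular, the degree of the minimal linear recurrence that $\{S(\sigma_{n,k})\}_{n\in\mathbb{N}}$ satisfies is $2\lfloor k/2\rfloor+\epsilon(k)$.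
   Context: $\mathbb{N}=\{1,2,3,\dots\}$. $S(\sigma_{n,k})$ is the exponential sum $\sum_{x\in\mathbb{F}_2^n}(-1)^{\sigma_{n,k}(x)}$ of the elementary symmetric polynomial of degree $k$ in $n$ variables, and it is defined for all $n$ by the displayed binomial sum. $\Phi_m$ denotes the $m$-th cyclotomic polynomial. A homogeneous linear recurrence $x_n=\sum_{i=1}^D a_ix_{n-i}$ with $a_i\in\mathbb{Z}$ has characteristic polynomial $x^D-\sum_{i=1}^D a_ix^{D-i}$; "minimal" means of least order $D$. -}

module Defs where

open import Data.Nat as ℕ using (ℕ; zero; suc; _∸_; _<_; _≡ᵇ_)
open import Data.Nat.DivMod using (_/_; _%_)
open import Data.Nat.Combinatorics using (_C_)
open import Data.Integer as ℤ using (ℤ; +_; -_; -1ℤ)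
open import Data.Fin using (Fin; zero; suc; toℕ)
open import Data.List using (List; []; _∷_; foldr; map; reverse)
open import Data.Bool using (if_then_else_)
open import Data.Product using (∃)
open import Relation.Binary.PropositionalEquality using (_≡_; _≢_)

sumTo : ℕ → (ℕ → ℤ) → ℤ
sumTo zero    f = f 0
sumTo (suc n) f = sumTo n f ℤ.+ f (suc n)

S : ℕ → ℕ → ℤ
S k n = sumTo n (λ j → (-1ℤ ℤ.^ (j C k)) ℤ.* (+ (n C j)))

-- Homogeneous linear recurrences x_n = Σ_{i=1}^{D} a_i x_{n-i}
-- with a : Fin D → ℤ, where a i stands for a_{toℕ i + 1}.

sumFin : (D : ℕ) → (Fin D → ℤ) → ℤ
sumFin zero    f = + 0
sumFin (suc D) f = f zero ℤ.+ sumFin D (λ i → f (suc i))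

-- The sequence s, indexed by ℕ = {1,2,...} (the value s 0 is never used),
-- satisfies the recurrence of order D with coefficients a.
Satisfies : (s : ℕ → ℤ) (D : ℕ) → (Fin D → ℤ) → Set
Satisfies s D a = ∀ n → D < n → s n ≡ sumFin D (λ i → a i ℤ.* s (n ∸ suc (toℕ i)))

MinimalRec : (s : ℕ → ℤ) (D : ℕ) → (Fin D → ℤ) → Set
MinimalRec s D a = Satisfies s D a × (∀ D′ (b : Fin D′ → ℤ) → Satisfies s D′ b → D ℕ.≤ D′)
  where open import Data.Product using (_×_)

-- Integer polynomials as coefficient lists (constant term first);
-- compared coefficientwise (so trailing zeros are irrelevant).

Poly : Set
Poly = List ℤ

coeff : Poly → ℕ → ℤ
coeff []      i       = + 0
coeff (c ∷ p) zero    = c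
coeff (c ∷ p) (suc i) = coeff p i

_≈P_ : Poly → Poly → Set
p ≈P q = ∀ i → coeff p i ≡ coeff q i

addP : Poly → Poly → Poly
addP []      q       = q
addP p       []      = p
addP (a ∷ p) (b ∷ q) = (a ℤ.+ b) ∷ addP p q

scaleP : ℤ → Poly → Poly
scaleP c p = map (c ℤ.*_) p

mulP : Poly → Poly → Poly
mulP []      q = []
mulP (a ∷ p) q = addP (scaleP a q) (+ 0 ∷ mulP p q)

powP : Poly → ℕ → Poly
powP p zero    = + 1 ∷ []
powP p (suc n) = mulP p (powP p n)

compP : Poly → Poly → Poly
compP p q = foldr (λ c acc → addP (c ∷ []) (mulP q acc)) [] p

Xp : Poly
Xp = + 0 ∷ + 1 ∷ []

Xm1 : Poly
Xm1 = -1ℤ ∷ + 1 ∷ []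

Xm2 : Poly
Xm2 = - (+ 2) ∷ + 1 ∷ []

-- Characteristic polynomial x^D - Σ_{i=1}^{D} a_i x^{D-i}:
-- coefficient list [-a_D, ..., -a_1, 1].
charPoly : (D : ℕ) → (Fin D → ℤ) → Poly
charPoly D a = reverse (+ 1 ∷ go D (λ i → a i))
  where
  go : (m : ℕ) → (Fin m → ℤ) → List ℤ
  go zero    f = []
  go (suc m) f = - (f zero) ∷ go m (λ i → f (suc i))

-- Cyclotomic polynomials of 2-power index:  Φ_{2^{a+1}}(x) = x^{2^a} + 1.
-- (Only these indices occur in the theorem.)

Φ2^suc : ℕ → Poly
Φ2^suc a = addP (powP Xp (2 ℕ.^ a)) (+ 1 ∷ [])

bit : ℕ → ℕ → ℕ
bit n zero    = n % 2
bit n (suc i) = bit (n / 2) i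

kbar : ℕ → ℕ
kbar k = 2 ℕ.* (k / 2) ℕ.+ 1

-- ∏ over i ∈ {1,..,m} with bit i of n equal to 1 of Φ_{2^{i+1}}(x-1).
-- With m = n this is exactly ∏_{j=1}^{l} Φ_{2^{a_j+1}}(x-1) for
-- n = 1 + 2^{a_1} + ... + 2^{a_l} (bits above ⌊log₂ n⌋ vanish).
bitProd : ℕ → ℕ → Poly
bitProd n zero    = + 1 ∷ []
bitProd n (suc i) =
  mulP (if bit n (suc i) ≡ᵇ 1 then compP (Φ2^suc (suc i)) Xm1 else (+ 1 ∷ []))
       (bitProd n i)

data Eps (k : ℕ) : ℕ → Set where
  pow2    : (m : ℕ) → k ≡ 2 ℕ.^ m → Eps k 0
  notPow2 : (∀ m → k ≢ 2 ℕ.^ m) → Eps k 1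

Ppoly : (k e : ℕ) → Poly
Ppoly k e = mulP (powP Xm2 e) (bitProd (kbar k) (kbar k))

{-# OPTIONS --safe #-}

-- Let E be the shift of sequences, act p s = p(E) s, let T be the binomial transform
-- T f n = Σ_j C(n,j) f(j), and put h k j = C(j,k) mod 2, H k = T (h k), so that
-- S k = 2^n - 2 H k.  As E T f = T ((1 + E) f), a polynomial in x - 1 acts on T f as the
-- polynomial in x acts on f.  By Lucas, E^(2^i) + 1 removes the bit 2^i from the index of h;
-- hence the product B of the cyclotomic factors sends H (2q + c), c ≤ 1, to H c, and the
-- sequence S k (1 + n) to K 2^n, where K = 0 exactly when k is a power of two.
-- Conversely, H k starts with k zeros followed by a one, so no nonzero polynomial of degree
-- at most k annihilates H k, and for even k those of degree k + 1 are the multiples of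
-- (x - 2) B.  This excludes every annihilator of S k (1 + n) of degree less than 2q + e:
-- such an r yields the annihilator x r (e = 1) or (x - 2) x r (e = 0) of H k.
module Submission where

open import Defs
open import Data.Nat using (ℕ; zero; suc; _≤_; _<_; _+_; _*_; _/_; _%_; _^_; _∸_; z≤n; s≤s; parity)
open import Data.Nat.Combinatorics using (_C_; nCk+nC[k+1]≡[n+1]C[k+1]; k>n⇒nCk≡0; nCn≡1)
open import Data.Nat.Divisibility using (divides-refl)
open import Data.Nat.DivMod using (m*n/n≡m; [m+kn]%n≡m%n; +-distrib-/-∣ˡ; m<n*o⇒m/o<n; m≡m%n+[m/n]*n; m%n<n)
import Data.Nat.Properties as ℕ
open import Data.Integer as ℤ using (ℤ; +_; -_; -1ℤ; 0ℤ; 1ℤ)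
import Data.Integer.Properties as ℤ
open import Data.Integer.Tactic.RingSolver using (solve-∀)
open import Data.Parity.Base as ℙ using (Parity; 0ℙ; 1ℙ)
import Data.Parity.Properties as ℙ
open import Data.Fin using (Fin; zero; suc; toℕ)
open import Data.List using (List; []; _∷_; _++_; reverse; length; foldl)
import Data.List.Properties as List
open import Data.Empty using (⊥-elim)
open import Data.Product using (Σ; _×_; _,_; proj₁; proj₂; ∃)
open import Data.Sum using (_⊎_; inj₁; inj₂)
open import Relation.Binary.Definitions using (tri<; tri≈; tri>)
open import Relation.Binary.PropositionalEquality
open import Relation.Nullary using (yes; no)
open ≡-Reasoning

-- Polynomials in the shift acting on sequences

act : Poly → (ℕ → ℤ) → ℕ → ℤ
act []      s n = 0ℤ
act (c ∷ p) s n = c ℤ.* s n ℤ.+ act p s (suc n)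

shift : (ℕ → ℤ) → ℕ → ℤ
shift s n = s (suc n)

act-cong : ∀ p {s t} → (∀ n → s n ≡ t n) → ∀ n → act p s n ≡ act p t n
act-cong []      s≗t n = refl
act-cong (c ∷ p) s≗t n = cong₂ (λ x y → c ℤ.* x ℤ.+ y) (s≗t n) (act-cong p s≗t (suc n))

act-shift : ∀ p s n → act p (shift s) n ≡ act p s (suc n)
act-shift []      s n = refl
act-shift (c ∷ p) s n = cong (ℤ._+_ (c ℤ.* s (suc n))) (act-shift p s (suc n))

act-+ : ∀ p s t n → act p (λ m → s m ℤ.+ t m) n ≡ act p s n ℤ.+ act p t n
act-+ []      s t n = refl
act-+ (c ∷ p) s t n rewrite act-+ p s t (suc n) =
  lemma c (s n) (t n) (act p s (suc n)) (act p t (suc n))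
  where
  lemma : ∀ c x y u v →
    c ℤ.* (x ℤ.+ y) ℤ.+ (u ℤ.+ v) ≡ (c ℤ.* x ℤ.+ u) ℤ.+ (c ℤ.* y ℤ.+ v)
  lemma = solve-∀

act-scale : ∀ p a s n → act p (λ m → a ℤ.* s m) n ≡ a ℤ.* act p s n
act-scale []      a s n = sym (ℤ.*-zeroʳ a)
act-scale (c ∷ p) a s n rewrite act-scale p a s (suc n) = lemma c a (s n) (act p s (suc n))
  where
  lemma : ∀ c a x u → c ℤ.* (a ℤ.* x) ℤ.+ a ℤ.* u ≡ a ℤ.* (c ℤ.* x ℤ.+ u)
  lemma = solve-∀

act-zero : ∀ p {s} → (∀ n → s n ≡ 0ℤ) → ∀ n → act p s n ≡ 0ℤ
act-zero []      s≗0 n = refl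
act-zero (c ∷ p) s≗0 n rewrite s≗0 n | act-zero p s≗0 (suc n) | ℤ.*-zeroʳ c = refl

act-addP : ∀ p q s n → act (addP p q) s n ≡ act p s n ℤ.+ act q s n
act-addP []      q       s n = sym (ℤ.+-identityˡ _)
act-addP (a ∷ p) []      s n = sym (ℤ.+-identityʳ _)
act-addP (a ∷ p) (b ∷ q) s n rewrite act-addP p q s (suc n) =
  lemma a b (s n) (act p s (suc n)) (act q s (suc n))
  where
  lemma : ∀ a b x u v → (a ℤ.+ b) ℤ.* x ℤ.+ (u ℤ.+ v) ≡ (a ℤ.* x ℤ.+ u) ℤ.+ (b ℤ.* x ℤ.+ v)
  lemma = solve-∀

act-scaleP : ∀ a p s n → act (scaleP a p) s n ≡ a ℤ.* act p s n
act-scaleP a []      s n = sym (ℤ.*-zeroʳ a)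
act-scaleP a (c ∷ p) s n rewrite act-scaleP a p s (suc n) = lemma a c (s n) (act p s (suc n))
  where
  lemma : ∀ a c x u → a ℤ.* c ℤ.* x ℤ.+ a ℤ.* u ≡ a ℤ.* (c ℤ.* x ℤ.+ u)
  lemma = solve-∀

act-0∷ : ∀ p s n → act (0ℤ ∷ p) s n ≡ act p s (suc n)
act-0∷ p s n = ℤ.+-identityˡ _

act-mulP : ∀ p q s n → act (mulP p q) s n ≡ act p (act q s) n
act-mulP []      q s n = refl
act-mulP (a ∷ p) q s n = begin
  act (addP (scaleP a q) (0ℤ ∷ mulP p q)) s n
    ≡⟨ act-addP (scaleP a q) _ s n ⟩
  act (scaleP a q) s n ℤ.+ act (0ℤ ∷ mulP p q) s n
    ≡⟨ cong₂ ℤ._+_ (act-scaleP a q s n) (act-0∷ (mulP p q) s n) ⟩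
  a ℤ.* act q s n ℤ.+ act (mulP p q) s (suc n)
    ≡⟨ cong (ℤ._+_ (a ℤ.* act q s n)) (act-mulP p q s (suc n)) ⟩
  a ℤ.* act q s n ℤ.+ act p (act q s) (suc n) ∎

-- Linearity and shift invariance of `act q` let it pass each coefficient of p. This allows a chosen
-- factor of a product to act first.
act-comm : ∀ p q s n → act p (act q s) n ≡ act q (act p s) n
act-comm []      q s n = sym (act-zero q (λ _ → refl) n)
act-comm (c ∷ p) q s n = begin
  c ℤ.* act q s n ℤ.+ act p (act q s) (suc n)
    ≡⟨ cong₂ ℤ._+_ (sym (act-scale q c s n)) (act-comm p q s (suc n)) ⟩
  act q (λ m → c ℤ.* s m) n ℤ.+ act q (act p s) (suc n)
    ≡⟨ cong (ℤ._+_ (act q (λ m → c ℤ.* s m) n)) (act-shift q (act p s) n) ⟨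
  act q (λ m → c ℤ.* s m) n ℤ.+ act q (shift (act p s)) n
    ≡⟨ act-+ q _ _ n ⟨
  act q (λ m → c ℤ.* s m ℤ.+ act p s (suc m)) n ∎

act-≈0 : ∀ p → (∀ i → coeff p i ≡ 0ℤ) → ∀ s n → act p s n ≡ 0ℤ
act-≈0 []      p≈0 s n = refl
act-≈0 (c ∷ p) p≈0 s n
  rewrite p≈0 0 | act-≈0 p (λ i → p≈0 (suc i)) s (suc n) = refl

act-++ : ∀ p q s n → act (p ++ q) s n ≡ act p s n ℤ.+ act q s (n + length p)
act-++ []      q s n rewrite ℕ.+-identityʳ n = sym (ℤ.+-identityˡ _)
act-++ (c ∷ p) q s n rewrite act-++ p q s (suc n) | ℕ.+-suc n (length p) =
  sym (ℤ.+-assoc (c ℤ.* s n) _ _)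

-- A sequence supported at 0 isolates the constant coefficient; `coeff-B-0` applies this to an
-- impulse written as a binomial transform.
act-impulse : ∀ p {s} → (∀ n → s (suc n) ≡ 0ℤ) → act p s 0 ≡ coeff p 0 ℤ.* s 0
act-impulse []      s≗0 = refl
act-impulse (c ∷ p) {s} s≗0 rewrite sym (act-shift p s 0) | act-zero p s≗0 0 =
  ℤ.+-identityʳ _

-- Coefficients and degrees

coeff-addP : ∀ p q i → coeff (addP p q) i ≡ coeff p i ℤ.+ coeff q i
coeff-addP []      q       i       = sym (ℤ.+-identityˡ _)
coeff-addP (a ∷ p) []      i       = sym (ℤ.+-identityʳ _)
coeff-addP (a ∷ p) (b ∷ q) zero    = refl
coeff-addP (a ∷ p) (b ∷ q) (suc i) = coeff-addP p q i

coeff-scaleP : ∀ a p i → coeff (scaleP a p) i ≡ a ℤ.* coeff p i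
coeff-scaleP a []      i       = sym (ℤ.*-zeroʳ a)
coeff-scaleP a (c ∷ p) zero    = refl
coeff-scaleP a (c ∷ p) (suc i) = coeff-scaleP a p i

coeff-mulP-∷ : ∀ a p q i →
  coeff (mulP (a ∷ p) q) i ≡ a ℤ.* coeff q i ℤ.+ coeff (0ℤ ∷ mulP p q) i
coeff-mulP-∷ a p q i =
  trans (coeff-addP (scaleP a q) _ i) (cong (ℤ._+ _) (coeff-scaleP a q i))

-- Lists may carry trailing zeros, so degree is bounded through coefficients and not through length;
-- the zero polynomial satisfies every bound.
DegreeBelow : ℕ → Poly → Set
DegreeBelow d p = ∀ i → d ≤ i → coeff p i ≡ 0ℤ

Monic : ℕ → Poly → Set
Monic d p = coeff p d ≡ 1ℤ × DegreeBelow (suc d) p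

mulP-≈0ˡ : ∀ p q → (∀ i → coeff p i ≡ 0ℤ) → ∀ i → coeff (mulP p q) i ≡ 0ℤ
mulP-≈0ˡ []      q p≈0 i = refl
mulP-≈0ˡ (a ∷ p) q p≈0 i rewrite coeff-mulP-∷ a p q i | p≈0 0 = lemma i
  where
  lemma : ∀ i → 0ℤ ℤ.+ coeff (0ℤ ∷ mulP p q) i ≡ 0ℤ
  lemma zero    = refl
  lemma (suc i) rewrite mulP-≈0ˡ p q (λ i → p≈0 (suc i)) i = refl

mulP-≈0ʳ : ∀ p q → (∀ i → coeff q i ≡ 0ℤ) → ∀ i → coeff (mulP p q) i ≡ 0ℤ
mulP-≈0ʳ []      q q≈0 i = refl
mulP-≈0ʳ (a ∷ p) q q≈0 i rewrite coeff-mulP-∷ a p q i | q≈0 i | ℤ.*-zeroʳ a = lemma i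
  where
  lemma : ∀ i → 0ℤ ℤ.+ coeff (0ℤ ∷ mulP p q) i ≡ 0ℤ
  lemma zero    = refl
  lemma (suc i) rewrite mulP-≈0ʳ p q q≈0 i = refl

-- With p = a + x p', the summand a q stays below the leading term of x p' q, which the induction
-- controls. In degree zero p may still have trailing zeros, hence the use of `mulP-≈0ˡ`.
monic-mulP : ∀ d p e q → Monic d p → Monic e q → Monic (d + e) (mulP p q)
monic-mulP d [] e q (() , _) _
monic-mulP zero (a ∷ p) e q (refl , deg-p) (lead-q , deg-q) =
  trans (mul e) lead-q , λ i e<i → trans (mul i) (deg-q i e<i)
  where
  mulP≈0 : ∀ i → coeff (0ℤ ∷ mulP p q) i ≡ 0ℤ
  mulP≈0 zero    = refl
  mulP≈0 (suc i) = mulP-≈0ˡ p q (λ i → deg-p (suc i) (s≤s z≤n)) i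
  mul : ∀ i → coeff (mulP (1ℤ ∷ p) q) i ≡ coeff q i
  mul i rewrite coeff-mulP-∷ 1ℤ p q i | mulP≈0 i | ℤ.*-identityˡ (coeff q i) =
    ℤ.+-identityʳ _
monic-mulP (suc d) (a ∷ p) e q (lead-p , deg-p) (lead-q , deg-q) = lead , deg
  where
  ih : Monic (d + e) (mulP p q)
  ih = monic-mulP d p e q (lead-p , λ i d<i → deg-p (suc i) (s≤s d<i)) (lead-q , deg-q)
  lead : coeff (mulP (a ∷ p) q) (suc (d + e)) ≡ 1ℤ
  lead rewrite coeff-mulP-∷ a p q (suc (d + e)) | deg-q (suc (d + e)) (s≤s (ℕ.m≤n+m e d))
             | ℤ.*-zeroʳ a | proj₁ ih = refl
  deg : DegreeBelow (suc (suc (d + e))) (mulP (a ∷ p) q)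
  deg (suc i) (s≤s d+e<i)
    rewrite coeff-mulP-∷ a p q (suc i)
          | deg-q (suc i) (ℕ.≤-trans (s≤s (ℕ.m≤n+m e d)) (ℕ.m≤n⇒m≤1+n d+e<i))
          | ℤ.*-zeroʳ a | proj₂ ih i d+e<i = refl

monic-1 : Monic 0 (1ℤ ∷ [])
monic-1 = refl , λ { (suc i) _ → refl }

monic-linear : ∀ c → Monic 1 (c ∷ 1ℤ ∷ [])
monic-linear c = refl , λ { (suc zero) (s≤s ()) ; (suc (suc i)) _ → refl }

monic-powP : ∀ p → Monic 1 p → ∀ n → Monic n (powP p n)
monic-powP p m zero    = monic-1
monic-powP p m (suc n) = monic-mulP 1 p n (powP p n) m (monic-powP p m n)

monic-add-constant : ∀ d p c → Monic (suc d) p → Monic (suc d) (addP (c ∷ []) p)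
monic-add-constant d (a ∷ p) c (lead , deg) = lead , λ { (suc i) d<i → deg (suc i) d<i }

addP-comm-constant : ∀ p c i → coeff (addP p (c ∷ [])) i ≡ coeff (addP (c ∷ []) p) i
addP-comm-constant p c i =
  trans (coeff-addP p _ i) (trans (ℤ.+-comm (coeff p i) _) (sym (coeff-addP (c ∷ []) p i)))

compP-≈0 : ∀ p q → (∀ i → coeff p i ≡ 0ℤ) → ∀ i → coeff (compP p q) i ≡ 0ℤ
compP-≈0 []      q p≈0 i = refl
compP-≈0 (c ∷ p) q p≈0 i
  rewrite coeff-addP (c ∷ []) (mulP q (compP p q)) i
        | mulP-≈0ʳ q (compP p q) (compP-≈0 p q (λ i → p≈0 (suc i))) i = lemma i
  where
  lemma : ∀ i → coeff (c ∷ []) i ℤ.+ 0ℤ ≡ 0ℤ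
  lemma zero    rewrite p≈0 0 = refl
  lemma (suc i) = refl

-- `compP` is Horner's scheme: each step multiplies by the monic linear q and adds a constant, which
-- cannot disturb a leading coefficient of positive degree.
monic-compP : ∀ d p q → Monic d p → Monic 1 q → Monic d (compP p q)
monic-compP d [] q (() , _) _
monic-compP zero (a ∷ p) q (refl , deg) mq = coeffs 0 , λ { (suc i) _ → coeffs (suc i) }
  where
  coeffs : ∀ i → coeff (compP (1ℤ ∷ p) q) i ≡ coeff (1ℤ ∷ []) i
  coeffs i
    rewrite coeff-addP (1ℤ ∷ []) (mulP q (compP p q)) i
          | mulP-≈0ʳ q (compP p q) (compP-≈0 p q (λ i → deg (suc i) (s≤s z≤n))) i =
    ℤ.+-identityʳ _
monic-compP (suc d) (a ∷ p) q (lead , deg) mq =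
  monic-add-constant d (mulP q (compP p q)) a
    (monic-mulP 1 q d (compP p q) mq (monic-compP d p q (lead , λ i d<i → deg (suc i) (s≤s d<i)) mq))

monic-Φ2^suc : ∀ a → Monic (2 ^ a) (Φ2^suc a)
monic-Φ2^suc a with 2 ^ a | ℕ.m^n>0 2 a
... | suc d | _ with monic-add-constant d (powP Xp (suc d)) 1ℤ (monic-powP Xp (monic-linear 0ℤ) (suc d))
... | lead , deg =
  trans (addP-comm-constant (powP Xp (suc d)) 1ℤ (suc d)) lead ,
  λ i d<i → trans (addP-comm-constant (powP Xp (suc d)) 1ℤ i) (deg i d<i)

-- act p s 0 is the coefficient of degree k; once that vanishes, act p s 1 is the one of
-- degree k - 1, and so on.
triangular : ∀ p k s → DegreeBelow (suc k) p → (∀ n → n < k → s n ≡ 0ℤ) → s k ≡ 1ℤ →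
  (∀ n → n ≤ k → act p s n ≡ 0ℤ) → ∀ i → coeff p i ≡ 0ℤ
triangular []      k s deg below lead kills i = refl
triangular (c ∷ p) k s deg below lead kills = coeffs
  where
  tail≈0 : ∀ k s → DegreeBelow (suc k) (c ∷ p) → (∀ n → n < k → s n ≡ 0ℤ) → s k ≡ 1ℤ →
    (∀ n → n ≤ k → act (c ∷ p) s n ≡ 0ℤ) → ∀ i → coeff p i ≡ 0ℤ
  tail≈0 zero    s deg below lead kills i = deg (suc i) (s≤s z≤n)
  tail≈0 (suc k) s deg below lead kills =
    triangular p k (shift s) (λ i k<i → deg (suc i) (s≤s k<i)) (λ n n<k → below (suc n) (s≤s n<k)) lead
      λ n n≤k → begin
        act p (shift s) n                        ≡⟨ act-shift p s n ⟩
        act p s (suc n)                          ≡⟨ ℤ.+-identityˡ _ ⟨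
        0ℤ ℤ.+ act p s (suc n)                   ≡⟨ cong (ℤ._+ act p s (suc n)) (ℤ.*-zeroʳ c) ⟨
        c ℤ.* 0ℤ ℤ.+ act p s (suc n)             ≡⟨ cong (λ x → c ℤ.* x ℤ.+ act p s (suc n)) (below n (s≤s n≤k)) ⟨
        act (c ∷ p) s n                          ≡⟨ kills n (ℕ.m≤n⇒m≤1+n n≤k) ⟩
        0ℤ ∎
  p≈0 : ∀ i → coeff p i ≡ 0ℤ
  p≈0 = tail≈0 k s deg below lead kills
  coeffs : ∀ i → coeff (c ∷ p) i ≡ 0ℤ
  coeffs (suc i) = p≈0 i
  coeffs zero    = begin
    c                                      ≡⟨ ℤ.*-identityʳ c ⟨
    c ℤ.* 1ℤ                               ≡⟨ cong (c ℤ.*_) lead ⟨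
    c ℤ.* s k                              ≡⟨ ℤ.+-identityʳ _ ⟨
    c ℤ.* s k ℤ.+ 0ℤ                       ≡⟨ cong (ℤ._+_ (c ℤ.* s k)) (act-≈0 p p≈0 s (suc k)) ⟨
    act (c ∷ p) s k                        ≡⟨ kills k ℕ.≤-refl ⟩
    0ℤ ∎

-- The characteristic polynomial of a recurrence

-- `go` is local to `charPoly`; the placeholder is solved by unification in
-- `charPoly-suc`, where the abstractions turn the arguments of `go` into variables.
mutual
  charPoly-go : (D : ℕ) → (Fin D → ℤ) → (m : ℕ) → (Fin m → ℤ) → List ℤ
  charPoly-go = _

  charPoly-suc : ∀ D (a : Fin (suc D) → ℤ) →
    charPoly (suc D) a ≡
      reverse (1ℤ ∷ - (a zero) ∷ charPoly-go (suc D) a D (λ i → a (suc i)))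
  charPoly-suc D a with a zero | (λ i → a (suc i))
  ... | c | f with suc D | a
  ... | N | b with foldl (λ l x → x ∷ l) (- c ∷ 1ℤ ∷ [])
  ... | rev = refl

-- The part of the characteristic polynomial below its leading 1, built directly in ascending order
-- so that `act-++` yields its action by recursion.
lowCoeffs : (m : ℕ) → (Fin m → ℤ) → Poly
lowCoeffs zero    f = []
lowCoeffs (suc m) f = lowCoeffs m (λ i → f (suc i)) ++ (- (f zero) ∷ [])

reverse-charPoly-go : ∀ D a m f → reverse (charPoly-go D a m f) ≡ lowCoeffs m f
reverse-charPoly-go D a zero    f = refl
reverse-charPoly-go D a (suc m) f =
  trans (List.unfold-reverse (- (f zero)) (charPoly-go D a m (λ i → f (suc i))))
        (cong (_++ (- (f zero) ∷ [])) (reverse-charPoly-go D a m (λ i → f (suc i))))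

charPoly-lowCoeffs : ∀ D a → charPoly D a ≡ lowCoeffs D a ++ (1ℤ ∷ [])
charPoly-lowCoeffs D a =
  trans (List.unfold-reverse 1ℤ (charPoly-go D a D a))
        (cong (_++ (1ℤ ∷ [])) (reverse-charPoly-go D a D a))

length-lowCoeffs : ∀ m f → length (lowCoeffs m f) ≡ m
length-lowCoeffs zero    f = refl
length-lowCoeffs (suc m) f =
  trans (List.length-++ (lowCoeffs m (λ i → f (suc i))))
        (trans (cong (_+ 1) (length-lowCoeffs m _)) (ℕ.+-comm m 1))

-- The last entry of the list, in position m, is minus the first recurrence coefficient; it
-- therefore multiplies s (n + m), the most recent term.
act-lowCoeffs : ∀ m f s n → act (lowCoeffs m f) s n ≡
  - sumFin m (λ i → f i ℤ.* s (n + m ∸ suc (toℕ i)))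
act-lowCoeffs zero    f s n = refl
act-lowCoeffs (suc m) f s n
  rewrite act-++ (lowCoeffs m (λ i → f (suc i))) (- (f zero) ∷ []) s n
        | act-lowCoeffs m (λ i → f (suc i)) s n
        | length-lowCoeffs m (λ i → f (suc i))
        | ℕ.+-suc n m
  = lemma (f zero) (s (n + m)) (sumFin m (λ i → f (suc i) ℤ.* s (n + m ∸ suc (toℕ i))))
  where
  lemma : ∀ c x u → - u ℤ.+ (- c ℤ.* x ℤ.+ 0ℤ) ≡ - (c ℤ.* x ℤ.+ u)
  lemma = solve-∀

act-charPoly : ∀ D a s n → act (charPoly D a) s n ≡
  s (n + D) ℤ.- sumFin D (λ i → a i ℤ.* s (n + D ∸ suc (toℕ i)))
act-charPoly D a s n
  rewrite charPoly-lowCoeffs D a | act-++ (lowCoeffs D a) (1ℤ ∷ []) s n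
        | act-lowCoeffs D a s n | length-lowCoeffs D a
  = lemma (s (n + D)) (sumFin D (λ i → a i ℤ.* s (n + D ∸ suc (toℕ i))))
  where
  lemma : ∀ x u → - u ℤ.+ (1ℤ ℤ.* x ℤ.+ 0ℤ) ≡ x ℤ.- u
  lemma = solve-∀

-- The first relation of a recurrence of order D is the one at index D + 1, whose oldest term is s
-- 1. Annihilation is therefore stated for `shift s`, which starts there.
satisfies⇒kills : ∀ s D a → Satisfies s D a → ∀ n → act (charPoly D a) (shift s) n ≡ 0ℤ
satisfies⇒kills s D a sat n = begin
  act (charPoly D a) (shift s) n ≡⟨ act-shift (charPoly D a) s n ⟩
  act (charPoly D a) s (suc n)   ≡⟨ act-charPoly D a s (suc n) ⟩
  s (suc n + D) ℤ.- _            ≡⟨ ℤ.i≡j⇒i-j≡0 (sat (suc n + D) (s≤s (ℕ.m≤n+m D n))) ⟩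
  0ℤ ∎

kills⇒satisfies : ∀ s D a → (∀ n → act (charPoly D a) (shift s) n ≡ 0ℤ) → Satisfies s D a
kills⇒satisfies s D a kills (suc n) (s≤s D≤n) =
  subst (λ m → s m ≡ sumFin D (λ i → a i ℤ.* s (m ∸ suc (toℕ i))))
    (cong suc (ℕ.m∸n+n≡m D≤n))
    (ℤ.i-j≡0⇒i≡j _ _ (begin
      s (suc (n ∸ D) + D) ℤ.- _            ≡⟨ act-charPoly D a s (suc (n ∸ D)) ⟨
      act (charPoly D a) s (suc (n ∸ D))   ≡⟨ act-shift (charPoly D a) s (n ∸ D) ⟨
      act (charPoly D a) (shift s) (n ∸ D) ≡⟨ kills (n ∸ D) ⟩
      0ℤ ∎))

coeff-++-< : ∀ p q i → i < length p → coeff (p ++ q) i ≡ coeff p i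
coeff-++-< (c ∷ p) q zero    _         = refl
coeff-++-< (c ∷ p) q (suc i) (s≤s i<p) = coeff-++-< p q i i<p

coeff-++-≥ : ∀ p q i → coeff (p ++ q) (length p + i) ≡ coeff q i
coeff-++-≥ []      q i = refl
coeff-++-≥ (c ∷ p) q i = coeff-++-≥ p q i

monic-∷ʳ : ∀ p → Monic (length p) (p ++ (1ℤ ∷ []))
monic-∷ʳ []      = monic-1
monic-∷ʳ (c ∷ p) with monic-∷ʳ p
... | lead , deg = lead , λ { (suc i) (s≤s p<i) → deg i p<i }

monic-charPoly : ∀ D a → Monic D (charPoly D a)
monic-charPoly D a =
  subst₂ Monic (length-lowCoeffs D a) (sym (charPoly-lowCoeffs D a)) (monic-∷ʳ (lowCoeffs D a))

lowCoeffs-surjective : ∀ p m → Σ (Fin m → ℤ) λ a → ∀ i → i < m → coeff (lowCoeffs m a) i ≡ coeff p i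
lowCoeffs-surjective p zero    = (λ ()) , λ _ ()
lowCoeffs-surjective p (suc m) with lowCoeffs-surjective p m
... | a , low = a′ , low′
  where
  a′ : Fin (suc m) → ℤ
  a′ zero    = - coeff p m
  a′ (suc i) = a i
  low′ : ∀ i → i < suc m → coeff (lowCoeffs (suc m) a′) i ≡ coeff p i
  low′ i (s≤s i≤m) with ℕ.m≤n⇒m<n∨m≡n i≤m
  ... | inj₁ i<m =
    trans (coeff-++-< (lowCoeffs m a) _ i (subst (i <_) (sym (length-lowCoeffs m a)) i<m)) (low i i<m)
  ... | inj₂ refl = begin
    coeff (lowCoeffs (suc m) a′) m                              ≡⟨ cong (coeff (lowCoeffs (suc m) a′)) m≡ ⟨
    coeff (lowCoeffs (suc m) a′) (length (lowCoeffs m a) + 0)   ≡⟨ coeff-++-≥ (lowCoeffs m a) _ 0 ⟩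
    - (- coeff p m)                                             ≡⟨ ℤ.neg-involutive _ ⟩
    coeff p m ∎
    where
    m≡ : length (lowCoeffs m a) + 0 ≡ m
    m≡ = trans (ℕ.+-identityʳ _) (length-lowCoeffs m a)

-- Turns a monic annihilator into an integer recurrence: the coefficients below the leading one can
-- be prescribed freely.
monic⇒charPoly : ∀ p D → Monic D p → Σ (Fin D → ℤ) λ a → charPoly D a ≈P p
monic⇒charPoly p D (lead , deg) with lowCoeffs-surjective p D
... | a , low = a , same
  where
  same : charPoly D a ≈P p
  same i with ℕ.<-cmp i D | monic-charPoly D a
  ... | tri≈ _ refl _ | lead′ , _ = trans lead′ (sym lead)
  ... | tri> _ _ D<i  | _ , deg′ = trans (deg′ i D<i) (sym (deg i D<i))
  ... | tri< i<D _ _  | _ rewrite charPoly-lowCoeffs D a =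
    trans (coeff-++-< (lowCoeffs D a) _ i (subst (i <_) (sym (length-lowCoeffs D a)) i<D)) (low i i<D)

-- The binomial transform

-- Pascal's rule taken as the definition: E T f = T f + T (E f) then holds by computation, and
-- `T-sumTo` recovers the binomial sum.
T : (ℕ → ℤ) → ℕ → ℤ
T f zero    = f 0
T f (suc n) = T f n ℤ.+ T (shift f) n

T-cong : ∀ {f g} → (∀ j → f j ≡ g j) → ∀ n → T f n ≡ T g n
T-cong f≗g zero    = f≗g 0
T-cong f≗g (suc n) = cong₂ ℤ._+_ (T-cong f≗g n) (T-cong (λ j → f≗g (suc j)) n)

T-+ : ∀ f g n → T (λ j → f j ℤ.+ g j) n ≡ T f n ℤ.+ T g n
T-+ f g zero    = refl
T-+ f g (suc n) rewrite T-+ f g n | T-+ (shift f) (shift g) n =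
  lemma (T f n) (T g n) (T (shift f) n) (T (shift g) n)
  where
  lemma : ∀ x y u v → (x ℤ.+ y) ℤ.+ (u ℤ.+ v) ≡ (x ℤ.+ u) ℤ.+ (y ℤ.+ v)
  lemma = solve-∀

T-scale : ∀ a f n → T (λ j → a ℤ.* f j) n ≡ a ℤ.* T f n
T-scale a f zero    = refl
T-scale a f (suc n) rewrite T-scale a f n | T-scale a (shift f) n =
  sym (ℤ.*-distribˡ-+ a (T f n) (T (shift f) n))

T-first : ∀ f n → (∀ j → j < n → f j ≡ 0ℤ) → T f n ≡ f n
T-first f zero    below = refl
T-first f (suc n) below
  rewrite T-first f n (λ j j<n → below j (ℕ.m≤n⇒m≤1+n j<n))
        | T-first (shift f) n (λ j j<n → below (suc j) (s≤s j<n))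
        | below n ℕ.≤-refl = ℤ.+-identityˡ _

sumTo-cong : ∀ n {f g} → (∀ j → f j ≡ g j) → sumTo n f ≡ sumTo n g
sumTo-cong zero    f≗g = f≗g 0
sumTo-cong (suc n) f≗g = cong₂ ℤ._+_ (sumTo-cong n f≗g) (f≗g (suc n))

sumTo-+ : ∀ n f g → sumTo n (λ j → f j ℤ.+ g j) ≡ sumTo n f ℤ.+ sumTo n g
sumTo-+ zero    f g = refl
sumTo-+ (suc n) f g rewrite sumTo-+ n f g =
  lemma (sumTo n f) (sumTo n g) (f (suc n)) (g (suc n))
  where
  lemma : ∀ x y u v → (x ℤ.+ y) ℤ.+ (u ℤ.+ v) ≡ (x ℤ.+ u) ℤ.+ (y ℤ.+ v)
  lemma = solve-∀

sumTo-head : ∀ n f → sumTo (suc n) f ≡ f 0 ℤ.+ sumTo n (shift f)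
sumTo-head zero    f = refl
sumTo-head (suc n) f rewrite sumTo-head n f = ℤ.+-assoc (f 0) _ _

T-sumTo : ∀ f n → T f n ≡ sumTo n (λ j → f j ℤ.* + (n C j))
T-sumTo f zero    = sym (ℤ.*-identityʳ (f 0))
T-sumTo f (suc n) = sym (begin
  sumTo (suc n) (λ j → f j ℤ.* + (suc n C j))
    ≡⟨ sumTo-head n _ ⟩
  f 0 ℤ.* + (suc n C 0) ℤ.+ sumTo n (λ j → f (suc j) ℤ.* + (suc n C suc j))
    ≡⟨ cong (ℤ._+_ (f 0 ℤ.* 1ℤ)) (trans (sumTo-cong n pascal) (sumTo-+ n _ _)) ⟩
  f 0 ℤ.* 1ℤ ℤ.+ (A ℤ.+ B)
    ≡⟨ lemma (f 0 ℤ.* 1ℤ) A B ⟩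
  (f 0 ℤ.* 1ℤ ℤ.+ B) ℤ.+ A
    ≡⟨ cong (ℤ._+ A) (sumTo-head n (λ j → f j ℤ.* + (n C j))) ⟨
  (sumTo n (λ j → f j ℤ.* + (n C j)) ℤ.+ f (suc n) ℤ.* + (n C suc n)) ℤ.+ A
    ≡⟨ cong₂ ℤ._+_ top (sym (T-sumTo (shift f) n)) ⟩
  T f n ℤ.+ T (shift f) n ∎)
  where
  A B : ℤ
  A = sumTo n (λ j → f (suc j) ℤ.* + (n C j))
  B = sumTo n (λ j → f (suc j) ℤ.* + (n C suc j))
  pascal : ∀ j → f (suc j) ℤ.* + (suc n C suc j) ≡
                 f (suc j) ℤ.* + (n C j) ℤ.+ f (suc j) ℤ.* + (n C suc j)
  pascal j = trans (cong (λ m → f (suc j) ℤ.* + m) (sym (nCk+nC[k+1]≡[n+1]C[k+1] n j)))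
                   (ℤ.*-distribˡ-+ (f (suc j)) (+ (n C j)) (+ (n C suc j)))
  lemma : ∀ x a b → x ℤ.+ (a ℤ.+ b) ≡ (x ℤ.+ b) ℤ.+ a
  lemma = solve-∀
  -- `sumTo-head` leaves a sum that runs to j = n + 1; its extra term has binomial coefficient zero.
  top : sumTo n (λ j → f j ℤ.* + (n C j)) ℤ.+ f (suc n) ℤ.* + (n C suc n) ≡ T f n
  top rewrite k>n⇒nCk≡0 (ℕ.n<1+n n) | ℤ.*-zeroʳ (f (suc n)) =
    trans (ℤ.+-identityʳ _) (sym (T-sumTo f n))

-- One Horner step multiplies by x - 1, which acts as E - 1, and (E - 1) T g = T (E g).
act-compP-T : ∀ p f n → act (compP p Xm1) (T f) n ≡ T (act p f) n
act-compP-T []      f n = sym (T-zero n)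
  where
  T-zero : ∀ n → T (λ _ → 0ℤ) n ≡ 0ℤ
  T-zero n = T-first (λ _ → 0ℤ) n (λ _ _ → refl)
act-compP-T (c ∷ p) f n = begin
  act (addP (c ∷ []) (mulP Xm1 q)) (T f) n
    ≡⟨ act-addP (c ∷ []) (mulP Xm1 q) (T f) n ⟩
  (c ℤ.* T f n ℤ.+ 0ℤ) ℤ.+ act (mulP Xm1 q) (T f) n
    ≡⟨ cong (ℤ._+_ (c ℤ.* T f n ℤ.+ 0ℤ)) (trans (act-mulP Xm1 q (T f) n) (act-cong Xm1 (act-compP-T p f) n)) ⟩
  (c ℤ.* T f n ℤ.+ 0ℤ) ℤ.+ act Xm1 (T (act p f)) n
    ≡⟨ lemma (c ℤ.* T f n) (T (act p f) n) (T (shift (act p f)) n) ⟩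
  c ℤ.* T f n ℤ.+ T (shift (act p f)) n
    ≡⟨ cong (ℤ._+ T (shift (act p f)) n) (T-scale c f n) ⟨
  T (λ j → c ℤ.* f j) n ℤ.+ T (shift (act p f)) n
    ≡⟨ T-+ (λ j → c ℤ.* f j) (shift (act p f)) n ⟨
  T (act (c ∷ p) f) n ∎
  where
  q : Poly
  q = compP p Xm1
  lemma : ∀ x u v → (x ℤ.+ 0ℤ) ℤ.+ (-1ℤ ℤ.* u ℤ.+ (1ℤ ℤ.* (u ℤ.+ v) ℤ.+ 0ℤ)) ≡ x ℤ.+ v
  lemma = solve-∀

act-powP-Xp : ∀ m s n → act (powP Xp m) s n ≡ s (n + m)
act-powP-Xp zero    s n rewrite ℕ.+-identityʳ n = lemma (s n)
  where
  lemma : ∀ x → 1ℤ ℤ.* x ℤ.+ 0ℤ ≡ x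
  lemma = solve-∀
act-powP-Xp (suc m) s n
  rewrite act-mulP Xp (powP Xp m) s n | act-powP-Xp m s (suc n) | ℕ.+-suc n m =
    lemma (act (powP Xp m) s n) (s (suc (n + m)))
  where
  lemma : ∀ u x → 0ℤ ℤ.* u ℤ.+ (1ℤ ℤ.* x ℤ.+ 0ℤ) ≡ x
  lemma = solve-∀

act-Φ2^suc : ∀ a s n → act (Φ2^suc a) s n ≡ s (n + 2 ^ a) ℤ.+ s n
act-Φ2^suc a s n
  rewrite act-addP (powP Xp (2 ^ a)) (1ℤ ∷ []) s n | act-powP-Xp (2 ^ a) s n =
    cong (ℤ._+_ (s (n + 2 ^ a))) (trans (ℤ.+-identityʳ _) (ℤ.*-identityˡ _))

-- Binomial coefficients modulo 2

parity-pascal : ∀ n k → parity (suc n C suc k) ≡ parity (n C k) ℙ.+ parity (n C suc k)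
parity-pascal n k =
  trans (cong parity (sym (nCk+nC[k+1]≡[n+1]C[k+1] n k))) (ℙ.+-homo-+ (n C k) (n C suc k))

-- Lucas' theorem for the last binary digit. The four cases are proved together, Pascal's rule
-- deriving each row from the one above it.
parity-even-even : ∀ m q → parity ((m * 2) C (q * 2)) ≡ parity (m C q)
parity-even-odd  : ∀ m q → parity ((m * 2) C suc (q * 2)) ≡ 0ℙ
parity-odd-even  : ∀ m q → parity (suc (m * 2) C (q * 2)) ≡ parity (m C q)
parity-odd-odd   : ∀ m q → parity (suc (m * 2) C suc (q * 2)) ≡ parity (m C q)

parity-even-even m       zero    = refl
parity-even-even zero    (suc q) = refl
parity-even-even (suc m) (suc q)
  rewrite parity-pascal (suc (m * 2)) (suc (q * 2)) | parity-odd-odd m q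
        | parity-odd-even m (suc q) = sym (parity-pascal m q)

parity-even-odd zero    q = refl
parity-even-odd (suc m) q
  rewrite parity-pascal (suc (m * 2)) (q * 2) | parity-odd-even m q | parity-odd-odd m q =
  p+p (parity (m C q))
  where
  p+p : ∀ p → p ℙ.+ p ≡ 0ℙ
  p+p 0ℙ = refl
  p+p 1ℙ = refl

parity-odd-even m zero    = refl
parity-odd-even m (suc q)
  rewrite parity-pascal (m * 2) (suc (q * 2)) | parity-even-odd m q =
  parity-even-even m (suc q)

parity-odd-odd m q
  rewrite parity-pascal (m * 2) (q * 2) | parity-even-odd m q | parity-even-even m q =
  ℙ.+-identityʳ _

parityℤ : Parity → ℤ
parityℤ 0ℙ = 0ℤ
parityℤ 1ℙ = 1ℤ

-1^n : ∀ n → -1ℤ ℤ.^ n ≡ 1ℤ ℤ.+ - (+ 2) ℤ.* parityℤ (parity n)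
-1^n zero          = refl
-1^n (suc zero)    = refl
-1^n (suc (suc n)) = trans (lemma (-1ℤ ℤ.^ n)) (-1^n n)
  where
  lemma : ∀ x → -1ℤ ℤ.* (-1ℤ ℤ.* x) ≡ x
  lemma = solve-∀

h : ℕ → ℕ → ℤ
h k j = parityℤ (parity (j C k))

half : ∀ n → ∃ λ m → n ≡ m * 2 ⊎ n ≡ suc (m * 2)
half zero          = 0 , inj₁ refl
half (suc zero)    = 0 , inj₂ refl
half (suc (suc n)) with half n
... | m , inj₁ refl = suc m , inj₁ refl
... | m , inj₂ refl = suc m , inj₂ refl

-- Adding 2 ^ i to j flips bit i of j, and by Lucas h k j says that j has all the bits of k.
h-remove-bit : ∀ i k j → k < 2 ^ i → h (2 ^ i + k) (j + 2 ^ i) ℤ.+ h (2 ^ i + k) j ≡ h k j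
h-remove-bit zero zero j (s≤s z≤n) with half j
... | m , inj₁ refl rewrite ℕ.+-comm (m * 2) 1 | parity-odd-odd m 0 | parity-even-odd m 0 = refl
... | m , inj₂ refl rewrite ℕ.+-comm (m * 2) 1 | parity-odd-odd m 0 | parity-even-odd (suc m) 0 = refl
h-remove-bit (suc i) k j k<2^i rewrite ℕ.*-comm 2 (2 ^ i) with half k | half j
... | r , inj₁ refl | m , inj₁ refl
  rewrite sym (ℕ.*-distribʳ-+ 2 (2 ^ i) r) | sym (ℕ.*-distribʳ-+ 2 m (2 ^ i))
        | parity-even-even (m + 2 ^ i) (2 ^ i + r) | parity-even-even m (2 ^ i + r)
        | parity-even-even m r = h-remove-bit i r m (ℕ.*-cancelʳ-< 2 r _ k<2^i)
... | r , inj₁ refl | m , inj₂ refl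
  rewrite sym (ℕ.*-distribʳ-+ 2 (2 ^ i) r) | sym (ℕ.*-distribʳ-+ 2 m (2 ^ i))
        | parity-odd-even (m + 2 ^ i) (2 ^ i + r) | parity-odd-even m (2 ^ i + r)
        | parity-odd-even m r = h-remove-bit i r m (ℕ.*-cancelʳ-< 2 r _ k<2^i)
... | r , inj₂ refl | m , inj₁ refl
  rewrite ℕ.+-suc (2 ^ i * 2) (r * 2)
        | sym (ℕ.*-distribʳ-+ 2 (2 ^ i) r) | sym (ℕ.*-distribʳ-+ 2 m (2 ^ i))
        | parity-even-odd (m + 2 ^ i) (2 ^ i + r) | parity-even-odd m (2 ^ i + r)
        | parity-even-odd m r = refl
... | r , inj₂ refl | m , inj₂ refl
  rewrite ℕ.+-suc (2 ^ i * 2) (r * 2)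
        | sym (ℕ.*-distribʳ-+ 2 (2 ^ i) r) | sym (ℕ.*-distribʳ-+ 2 m (2 ^ i))
        | parity-odd-odd (m + 2 ^ i) (2 ^ i + r) | parity-odd-odd m (2 ^ i + r)
        | parity-odd-odd m r = h-remove-bit i r m (ℕ.*-cancelʳ-< 2 r _ (ℕ.<⇒≤ k<2^i))

-- The transforms `H k` and the exponential sum

H : ℕ → ℕ → ℤ
H k = T (h k)

h-below : ∀ k j → j < k → h k j ≡ 0ℤ
h-below k j j<k rewrite k>n⇒nCk≡0 j<k = refl

H-below : ∀ k n → n < k → H k n ≡ 0ℤ
H-below k n n<k =
  trans (T-first (h k) n (λ j j<n → h-below k j (ℕ.<-trans j<n n<k))) (h-below k n n<k)

H-diagonal : ∀ k → H k k ≡ 1ℤ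
H-diagonal k = trans (T-first (h k) k (h-below k)) (cong (λ m → parityℤ (parity m)) (nCn≡1 k))

-- Rests on (-1)^a = 1 - 2 (a mod 2). The term `H 0` is the transform of the constant 1, that is,
-- 2^n.
S-H : ∀ k n → S k n ≡ H 0 n ℤ.+ - (+ 2) ℤ.* H k n
S-H k n = begin
  S k n                                    ≡⟨ T-sumTo (λ j → -1ℤ ℤ.^ (j C k)) n ⟨
  T (λ j → -1ℤ ℤ.^ (j C k)) n              ≡⟨ T-cong (λ j → -1^n (j C k)) n ⟩
  T (λ j → 1ℤ ℤ.+ - (+ 2) ℤ.* h k j) n     ≡⟨ T-+ (λ _ → 1ℤ) (λ j → - (+ 2) ℤ.* h k j) n ⟩
  H 0 n ℤ.+ T (λ j → - (+ 2) ℤ.* h k j) n  ≡⟨ cong (ℤ._+_ (H 0 n)) (T-scale (- (+ 2)) (h k) n) ⟩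
  H 0 n ℤ.+ - (+ 2) ℤ.* H k n ∎

-- Binary expansions

-- Binary m q w: q has m digits, of which w are ones.
data Binary : ℕ → ℕ → ℕ → Set where
  none : Binary 0 0 0
  off  : ∀ {m q w} → Binary m q w → Binary (suc m) q w
  on   : ∀ {m q w} → Binary m q w → Binary (suc m) (2 ^ m + q) (suc w)

2^suc : ∀ m → 2 ^ suc m ≡ 2 ^ m + 2 ^ m
2^suc m = cong (_+_ (2 ^ m)) (ℕ.+-identityʳ (2 ^ m))

binary-< : ∀ {m q w} → Binary m q w → q < 2 ^ m
binary-< none                = s≤s z≤n
binary-< {suc m} (off b) rewrite 2^suc m = ℕ.<-≤-trans (binary-< b) (ℕ.m≤m+n _ _)
binary-< {suc m} (on b)  rewrite 2^suc m = ℕ.+-monoʳ-< (2 ^ m) (binary-< b)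

binary : ∀ m q → q < 2 ^ m → ∃ λ w → Binary m q w
binary zero    zero _  = 0 , none
binary zero (suc q) (s≤s ())
binary (suc m) q q< with q ℕ.<? 2 ^ m
... | yes q<2^m = let w , b = binary m q q<2^m in w , off b
... | no  q≮2^m = let w , b = binary m (q ∸ 2 ^ m) r< in suc w , subst (λ q → Binary (suc m) q (suc w)) split (on b)
  where
  split : 2 ^ m + (q ∸ 2 ^ m) ≡ q
  split = ℕ.m+[n∸m]≡n (ℕ.≮⇒≥ q≮2^m)
  r< : q ∸ 2 ^ m < 2 ^ m
  r< = ℕ.+-cancelˡ-< (2 ^ m) _ _ (subst₂ _<_ (sym split) (2^suc m) q<)

[2q+1]/2 : ∀ q → (2 * q + 1) / 2 ≡ q
[2q+1]/2 q rewrite ℕ.*-comm 2 q =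
  trans (+-distrib-/-∣ˡ 1 (divides-refl q)) (trans (ℕ.+-identityʳ _) (m*n/n≡m q 2))

half-2^ : ∀ m q → (2 ^ suc m + q) / 2 ≡ 2 ^ m + q / 2
half-2^ m q rewrite ℕ.*-comm 2 (2 ^ m) =
  trans (+-distrib-/-∣ˡ q (divides-refl (2 ^ m))) (cong (_+ q / 2) (m*n/n≡m (2 ^ m) 2))

half-< : ∀ m q → q < 2 ^ suc m → q / 2 < 2 ^ m
half-< m q q< = m<n*o⇒m/o<n (subst (q <_) (ℕ.*-comm 2 (2 ^ m)) q<)

bit-off : ∀ m q → q < 2 ^ m → bit q m ≡ 0
bit-off zero    zero _       = refl
bit-off zero (suc q) (s≤s ())
bit-off (suc m) q    q<      = bit-off m (q / 2) (half-< m q q<)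

bit-on : ∀ m q → q < 2 ^ m → bit (2 ^ m + q) m ≡ 1
bit-on zero    zero _        = refl
bit-on zero (suc q) (s≤s ())
bit-on (suc m) q    q<       =
  trans (cong (λ r → bit r m) (half-2^ m q)) (bit-on m (q / 2) (half-< m q q<))

bit-low : ∀ m q i → i < m → bit (2 ^ m + q) i ≡ bit q i
bit-low (suc m) q zero    _ rewrite ℕ.*-comm 2 (2 ^ m) | ℕ.+-comm (2 ^ m * 2) q =
  [m+kn]%n≡m%n q (2 ^ m) 2
bit-low (suc m) q (suc i) (s≤s i<m) =
  trans (cong (λ r → bit r i) (half-2^ m q)) (bit-low m (q / 2) i i<m)

-- The product of cyclotomic factors

-- Here q stands for k / 2, so that 2 q + 1 is `kbar k` and its bit i + 1 is bit i of q. The number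
-- m of factors is independent of q to allow induction along `Binary`.
B : ℕ → ℕ → Poly
B q m = bitProd (2 * q + 1) m

bit-2q+1 : ∀ q i → bit (2 * q + 1) (suc i) ≡ bit q i
bit-2q+1 q i = cong (λ r → bit r i) ([2q+1]/2 q)

bitProd-cong : ∀ n n′ m → (∀ i → i < m → bit n (suc i) ≡ bit n′ (suc i)) → bitProd n m ≡ bitProd n′ m
bitProd-cong n n′ zero    eq = refl
bitProd-cong n n′ (suc m) eq
  rewrite eq m ℕ.≤-refl | bitProd-cong n n′ m (λ i i<m → eq i (ℕ.m≤n⇒m≤1+n i<m)) = refl

B-off : ∀ m q → q < 2 ^ m → B q (suc m) ≡ mulP (1ℤ ∷ []) (B q m)
B-off m q q< rewrite bit-2q+1 q m | bit-off m q q< = refl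

factor : ℕ → Poly
factor m = compP (Φ2^suc (suc m)) Xm1

-- The factors below the top one depend only on the bits of q below m, which adding 2 ^ m does not
-- change.
B-on : ∀ m q → q < 2 ^ m → B (2 ^ m + q) (suc m) ≡ mulP (factor m) (B q m)
B-on m q q< rewrite bit-2q+1 (2 ^ m + q) m | bit-on m q q< =
  cong (mulP (factor m)) (bitProd-cong (2 * (2 ^ m + q) + 1) (2 * q + 1) m λ i i<m →
    trans (bit-2q+1 (2 ^ m + q) i) (trans (bit-low m q i i<m) (sym (bit-2q+1 q i))))

-- A binary one of weight 2 ^ m in q contributes a factor of degree 2 ^ (m + 1); these degrees add
-- up to 2 q.
monic-B : ∀ {m q w} → Binary m q w → Monic (2 * q) (B q m)
monic-B none = monic-1
monic-B (off {m} {q} b) rewrite B-off m q (binary-< b) =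
  monic-mulP 0 (1ℤ ∷ []) (2 * q) (B q m) monic-1 (monic-B b)
monic-B (on {m} {q} b)
  rewrite B-on m q (binary-< b) | ℕ.*-distribˡ-+ 2 (2 ^ m) q =
  monic-mulP (2 ^ suc m) (factor m) (2 * q) (B q m)
    (monic-compP (2 ^ suc m) (Φ2^suc (suc m)) Xm1 (monic-Φ2^suc (suc m)) (monic-linear -1ℤ))
    (monic-B b)

act-1 : ∀ s n → act (1ℤ ∷ []) s n ≡ s n
act-1 s n = trans (ℤ.+-identityʳ _) (ℤ.*-identityˡ (s n))

-- The top factor removes the top bit of the index. It has to act first, because the induction
-- hypothesis for the remaining factors concerns the reduced index.
act-B-H : ∀ {m q w} c → c ≤ 1 → Binary m q w → ∀ n → act (B q m) (H (2 * q + c)) n ≡ H c n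
act-B-H c c≤1 none n = act-1 (H c) n
act-B-H c c≤1 (off {m} {q} b) n rewrite B-off m q (binary-< b) =
  trans (act-mulP (1ℤ ∷ []) (B q m) (H (2 * q + c)) n)
        (trans (act-1 (act (B q m) (H (2 * q + c))) n) (act-B-H c c≤1 b n))
act-B-H c c≤1 (on {m} {q} b) n
  rewrite B-on m q (binary-< b) | ℕ.*-distribˡ-+ 2 (2 ^ m) q | ℕ.+-assoc (2 ^ suc m) (2 * q) c =
  begin
  act (mulP (factor m) (B q m)) (H k) n   ≡⟨ act-mulP (factor m) (B q m) (H k) n ⟩
  act (factor m) (act (B q m) (H k)) n    ≡⟨ act-comm (factor m) (B q m) (H k) n ⟩
  act (B q m) (act (factor m) (H k)) n    ≡⟨ act-cong (B q m) remove n ⟩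
  act (B q m) (H (2 * q + c)) n           ≡⟨ act-B-H c c≤1 b n ⟩
  H c n ∎
  where
  k : ℕ
  k = 2 ^ suc m + (2 * q + c)
  -- Doubling q + 1 ≤ 2 ^ m gives 2 q + 2 ≤ 2 ^ (m + 1), which leaves room for c ≤ 1.
  k< : 2 * q + c < 2 ^ suc m
  k< = ℕ.≤-trans (s≤s (ℕ.+-monoʳ-≤ (2 * q) c≤1))
         (subst (_≤ 2 ^ suc m) (trans (ℕ.*-suc 2 q) (trans (ℕ.+-comm 2 (2 * q)) (ℕ.+-suc (2 * q) 1)))
           (ℕ.*-monoʳ-≤ 2 (binary-< b)))
  remove : ∀ n → act (factor m) (H k) n ≡ H (2 * q + c) n
  remove n = trans (act-compP-T (Φ2^suc (suc m)) (h k) n)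
    (T-cong (λ j → trans (act-Φ2^suc (suc m) (h k) j) (h-remove-bit (suc m) (2 * q + c) j k<)) n)

-- Every factor comes from x^(2^i) + 1 with i ≥ 1, which doubles a sequence of period two; there are
-- w such factors. It is applied to the constant 1 and to the alternating sequence.
act-B-periodic : ∀ {m q w} f → (∀ j → f (2 + j) ≡ f j) → Binary m q w → ∀ n →
  act (B q m) (T f) n ≡ + (2 ^ w) ℤ.* T f n
act-B-periodic f per none n = ℤ.+-identityʳ _
act-B-periodic f per (off {m} {q} b) n rewrite B-off m q (binary-< b) =
  trans (act-mulP (1ℤ ∷ []) (B q m) (T f) n)
        (trans (act-1 (act (B q m) (T f)) n) (act-B-periodic f per b n))
act-B-periodic f per (on {m} {q} {w} b) n rewrite B-on m q (binary-< b) = begin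
  act (mulP (factor m) (B q m)) (T f) n   ≡⟨ act-mulP (factor m) (B q m) (T f) n ⟩
  act (factor m) (act (B q m) (T f)) n    ≡⟨ act-comm (factor m) (B q m) (T f) n ⟩
  act (B q m) (act (factor m) (T f)) n    ≡⟨ act-cong (B q m) double n ⟩
  act (B q m) (λ j → + 2 ℤ.* T f j) n     ≡⟨ act-scale (B q m) (+ 2) (T f) n ⟩
  + 2 ℤ.* act (B q m) (T f) n             ≡⟨ cong (ℤ._*_ (+ 2)) (act-B-periodic f per b n) ⟩
  + 2 ℤ.* (+ (2 ^ w) ℤ.* T f n)           ≡⟨ ℤ.*-assoc (+ 2) (+ (2 ^ w)) (T f n) ⟨
  + 2 ℤ.* + (2 ^ w) ℤ.* T f n             ≡⟨ cong (ℤ._* T f n) (ℤ.pos-* 2 (2 ^ w)) ⟨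
  + (2 ^ suc w) ℤ.* T f n ∎
  where
  even-period : ∀ r j → f (j + r * 2) ≡ f j
  even-period zero    j rewrite ℕ.+-identityʳ j = refl
  even-period (suc r) j rewrite ℕ.+-suc j (suc (r * 2)) | ℕ.+-suc j (r * 2) =
    trans (per _) (even-period r j)
  double : ∀ n → act (factor m) (T f) n ≡ + 2 ℤ.* T f n
  double n = trans (act-compP-T (Φ2^suc (suc m)) f n) (trans (T-cong f+f n) (T-scale (+ 2) f n))
    where
    2x : ∀ x → x ℤ.+ x ≡ + 2 ℤ.* x
    2x = solve-∀
    f+f : ∀ j → act (Φ2^suc (suc m)) f j ≡ + 2 ℤ.* f j
    f+f j rewrite act-Φ2^suc (suc m) f j | ℕ.*-comm 2 (2 ^ m) | even-period (2 ^ m) j = 2x (f j)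

-- Minimal recurrences from minimal annihilators

diffP : Poly → Poly → Poly
diffP p q = addP p (scaleP -1ℤ q)

coeff-diffP : ∀ p q i → coeff (diffP p q) i ≡ coeff p i ℤ.- coeff q i
coeff-diffP p q i =
  trans (coeff-addP p _ i)
        (cong (ℤ._+_ (coeff p i)) (trans (coeff-scaleP -1ℤ q i) (ℤ.-1*i≡-i (coeff q i))))

act-diffP : ∀ p q s n → act (diffP p q) s n ≡ act p s n ℤ.- act q s n
act-diffP p q s n =
  trans (act-addP p _ s n)
        (cong (ℤ._+_ (act p s n)) (trans (act-scaleP -1ℤ q s n) (ℤ.-1*i≡-i (act q s n))))

act-≈ : ∀ p q → p ≈P q → ∀ s n → act p s n ≡ act q s n
act-≈ p q p≈q s n = ℤ.i-j≡0⇒i≡j _ _ (trans (sym (act-diffP p q s n))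
  (act-≈0 (diffP p q) (λ i → trans (coeff-diffP p q i) (ℤ.i≡j⇒i-j≡0 (p≈q i))) s n))

-- A characteristic polynomial is monic, hence nonzero, so no recurrence has order below d. Two
-- monic annihilators of degree d differ by one of smaller degree, which must vanish.
minimalRec-charPoly : ∀ (s : ℕ → ℤ) d p → Monic d p →
  (∀ n → act p (shift s) n ≡ 0ℤ) →
  (∀ r → DegreeBelow d r → (∀ n → act r (shift s) n ≡ 0ℤ) → ∀ i → coeff r i ≡ 0ℤ) →
  (Σ ℕ λ D → Σ (Fin D → ℤ) λ a → MinimalRec s D a × charPoly D a ≈P p)
  × (∀ D (a : Fin D → ℤ) → MinimalRec s D a → charPoly D a ≈P p × D ≡ d)
minimalRec-charPoly s d p (lead , deg) kills least with monic⇒charPoly p d (lead , deg)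
... | a₀ , a₀≈p = (d , a₀ , (sat₀ , bound) , a₀≈p) , unique
  where
  sat₀ : Satisfies s d a₀
  sat₀ = kills⇒satisfies s d a₀ λ n → trans (act-≈ (charPoly d a₀) p a₀≈p (shift s) n) (kills n)

  bound : ∀ D (b : Fin D → ℤ) → Satisfies s D b → d ≤ D
  bound D b sat with monic-charPoly D b
  ... | lead′ , deg′ = ℕ.≮⇒≥ λ D<d →
    1≢0 (trans (sym lead′) (least (charPoly D b) (λ i d≤i → deg′ i (ℕ.<-≤-trans D<d d≤i))
                              (satisfies⇒kills s D b sat) D))
    where
    1≢0 : 1ℤ ≢ 0ℤ
    1≢0 ()

  same-degree : ∀ (a : Fin d → ℤ) → Satisfies s d a → charPoly d a ≈P p
  same-degree a sat i with monic-charPoly d a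
  ... | lead′ , deg′ = ℤ.i-j≡0⇒i≡j _ _ (trans (sym (coeff-diffP Q p i)) (least (diffP Q p) diff-deg diff-kills i))
    where
    Q : Poly
    Q = charPoly d a
    diff-deg : DegreeBelow d (diffP Q p)
    diff-deg j d≤j with ℕ.m≤n⇒m<n∨m≡n d≤j
    ... | inj₁ d<j rewrite coeff-diffP Q p j | deg′ j d<j | deg j d<j = refl
    ... | inj₂ refl rewrite coeff-diffP Q p d | lead′ | lead = refl
    diff-kills : ∀ n → act (diffP Q p) (shift s) n ≡ 0ℤ
    diff-kills n rewrite act-diffP Q p (shift s) n | satisfies⇒kills s d a sat n | kills n = refl

  unique : ∀ D (a : Fin D → ℤ) → MinimalRec s D a → charPoly D a ≈P p × D ≡ d
  unique D a (sat , min) with ℕ.≤-antisym (min d a₀ sat₀) (bound D a sat)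
  ... | refl = same-degree a sat , refl

-- Powers of two

binary-0 : ∀ {m q w} → Binary m q w → q ≡ 0 → w ≡ 0
binary-0 none    _   = refl
binary-0 (off b) q≡0 = binary-0 b q≡0
binary-0 (on {m} {q} b) eq with 2 ^ m | ℕ.m^n>0 2 m | eq
... | suc _ | _ | ()

binary-weight-0 : ∀ {m q} → Binary m q 0 → q ≡ 0
binary-weight-0 none    = refl
binary-weight-0 (off b) = binary-weight-0 b

binary-weight-1 : ∀ {m q} → Binary m q 1 → ∃ λ a → q ≡ 2 ^ a
binary-weight-1 (off b)    = binary-weight-1 b
binary-weight-1 (on {m} b) = m , trans (cong (_+_ (2 ^ m)) (binary-weight-0 b)) (ℕ.+-identityʳ _)

-- The leading one determines the size: a number with leading term 2 ^ m can equal 2 ^ a only if a =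
-- m, and then nothing remains below it.
binary-2^ : ∀ {m q w} a → Binary m q w → q ≡ 2 ^ a → w ≡ 1
binary-2^ a none eq with 2 ^ a | ℕ.m^n>0 2 a | eq
... | suc _ | _ | ()
binary-2^ a (off b) eq = binary-2^ a b eq
binary-2^ a (on {m} {q} b) eq with ℕ.<-cmp a m
... | tri< a<m _ _ = ⊥-elim (ℕ.<⇒≱ (ℕ.^-monoʳ-< 2 (s≤s (s≤s z≤n)) a<m) (subst (2 ^ m ≤_) eq (ℕ.m≤m+n _ q)))
... | tri≈ _ refl _ = cong suc (binary-0 b (ℕ.+-cancelˡ-≡ (2 ^ m) q 0 (trans eq (sym (ℕ.+-identityʳ _)))))
... | tri> _ _ m<a = ⊥-elim (ℕ.<⇒≱ (binary-< (on b)) (subst (2 ^ suc m ≤_) (sym eq) (ℕ.^-monoʳ-≤ 2 m<a)))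

-- The number of binary ones of 2 q + c is w + c. Parity rules out the pairings of an even number
-- with 2 ^ 0 and of an odd number with a higher power.
weight-2^ : ∀ {m q w} c a → c ≤ 1 → Binary m q w → 2 * q + c ≡ 2 ^ a → w + c ≡ 1
weight-2^ {q = q} {w} zero zero c≤1 b eq =
  ⊥-elim (ℕ.even≢odd q 0 (trans (sym (ℕ.+-identityʳ (2 * q))) eq))
weight-2^ {q = q} {w} zero (suc a) c≤1 b eq = trans (ℕ.+-identityʳ w)
  (binary-2^ a b (ℕ.*-cancelˡ-≡ q (2 ^ a) 2 (trans (sym (ℕ.+-identityʳ _)) eq)))
weight-2^ {q = zero} {w} (suc zero) zero c≤1 b eq = cong (_+ 1) (binary-0 b refl)
weight-2^ {q = suc q} {w} (suc zero) zero c≤1 b eq with trans (ℕ.+-comm 1 (2 * suc q)) eq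
... | ()
weight-2^ {q = q} {w} (suc zero) (suc a) c≤1 b eq =
  ⊥-elim (ℕ.even≢odd (2 ^ a) q (trans (sym eq) (ℕ.+-comm _ 1)))
weight-2^ (suc (suc c)) a (s≤s ()) b eq

weight-not2^ : ∀ {m q w} c → c ≤ 1 → Binary m q w → 1 ≤ 2 * q + c →
  (∀ a → 2 * q + c ≢ 2 ^ a) → 2 ≤ w + c
weight-not2^ {w = zero} zero c≤1 b pos not2^ with binary-weight-0 b
weight-not2^ {w = zero} zero c≤1 b () not2^ | refl
weight-not2^ {w = suc zero} zero c≤1 b pos not2^ with binary-weight-1 b
... | a , refl = ⊥-elim (not2^ (suc a) (ℕ.+-identityʳ _))
weight-not2^ {w = suc (suc w)} zero c≤1 b pos not2^ = s≤s (s≤s z≤n)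
weight-not2^ {w = zero} (suc zero) c≤1 b pos not2^ with binary-weight-0 b
... | refl = ⊥-elim (not2^ 0 refl)
weight-not2^ {w = suc w} (suc zero) c≤1 b pos not2^ = s≤s (ℕ.m≤n+m 1 w)
weight-not2^ (suc (suc c)) (s≤s ()) b pos not2^

-- The constant `K` and the constant coefficient of the product

-- At index n + 1 the product sends 2^n to 2 * 2^w * 2^n and `H k` to (2 - c) 2^n; `K` is the first
-- factor minus twice the second.
K : ℕ → ℕ → ℤ
K w c = + 2 ℤ.* (+ (2 ^ w) ℤ.- (+ 2 ℤ.- + c))

K≡0 : ∀ w c → w + c ≡ 1 → K w c ≡ 0ℤ
K≡0 zero       (suc zero) _  = refl
K≡0 (suc zero) zero       _  = refl

-- Vanishing would mean 2^w = 2 - c, but 2^w > 2 when c = 0 and w ≥ 2, and 2^w > 1 when c = 1 and w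
-- ≥ 1.
K≢0 : ∀ w c → c ≤ 1 → 2 ≤ w + c → K w c ≢ 0ℤ
K≢0 w c c≤1 2≤w+c eq with ℤ.i*j≡0⇒i≡0∨j≡0 (+ 2) eq
... | inj₂ eq′ = impossible w c c≤1 2≤w+c (ℤ.i-j≡0⇒i≡j _ _ eq′)
  where
  impossible : ∀ w c → c ≤ 1 → 2 ≤ w + c → + (2 ^ w) ≢ + 2 ℤ.- + c
  impossible (suc (suc w)) zero _ _ eq =
    ℕ.<⇒≱ (ℕ.^-monoʳ-< 2 (s≤s (s≤s z≤n)) {1} {suc (suc w)} (s≤s (s≤s z≤n))) (ℕ.≤-reflexive (ℤ.+-injective eq))
  impossible (suc w) (suc zero) _ _ eq =
    ℕ.<⇒≱ (ℕ.^-monoʳ-< 2 (s≤s (s≤s z≤n)) {0} {suc w} (s≤s z≤n)) (ℕ.≤-reflexive (ℤ.+-injective eq))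
  impossible (suc zero) zero _ (s≤s ())
  impossible zero (suc zero) _ (s≤s ())
  impossible _ (suc (suc c)) (s≤s ())

2*-cancel : ∀ x → + 2 ℤ.* x ≡ 0ℤ → x ≡ 0ℤ
2*-cancel x eq with ℤ.i*j≡0⇒i≡0∨j≡0 (+ 2) eq
... | inj₂ x≡0 = x≡0

act-Xm2-H0 : ∀ n → act Xm2 (H 0) n ≡ 0ℤ
act-Xm2-H0 n = lemma (H 0 n)
  where
  lemma : ∀ x → - (+ 2) ℤ.* x ℤ.+ (1ℤ ℤ.* (x ℤ.+ x) ℤ.+ 0ℤ) ≡ 0ℤ
  lemma = solve-∀

-- For c = 1, exactly one of j and j + 1 is odd, so the two transforms add up to that of the
-- constant 1. The formula starts at index 1, since `H 1 0` is zero.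
H-suc : ∀ c n → c ≤ 1 → H c (suc n) ≡ (+ 2 ℤ.- + c) ℤ.* H 0 n
H-suc zero n _ = lemma (H 0 n)
  where
  lemma : ∀ x → x ℤ.+ x ≡ + 2 ℤ.* x
  lemma = solve-∀
H-suc (suc zero) n _ = begin
  H 1 n ℤ.+ T (shift (h 1)) n        ≡⟨ ℤ.+-comm (H 1 n) _ ⟩
  T (shift (h 1)) n ℤ.+ H 1 n        ≡⟨ T-+ (shift (h 1)) (h 1) n ⟨
  T (λ j → h 1 (suc j) ℤ.+ h 1 j) n  ≡⟨ T-cong (λ j → trans (cong (λ m → h 1 m ℤ.+ h 1 j) (ℕ.+-comm 1 j)) (h-remove-bit 0 0 j (s≤s z≤n))) n ⟩
  H 0 n                              ≡⟨ ℤ.*-identityˡ _ ⟨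
  1ℤ ℤ.* H 0 n ∎
H-suc (suc (suc c)) n (s≤s ())

-- Its transform is (1 - 1)^n, the unit impulse at 0, while the sequence itself has period two.
alternating : ℕ → ℤ
alternating zero    = 1ℤ
alternating (suc j) = - alternating j

T-alternating : ∀ n → T alternating (suc n) ≡ 0ℤ
T-alternating n = begin
  T alternating n ℤ.+ T (shift alternating) n
    ≡⟨ T-+ alternating (shift alternating) n ⟨
  T (λ j → alternating j ℤ.- alternating j) n
    ≡⟨ T-first _ n (λ j _ → ℤ.+-inverseʳ (alternating j)) ⟩
  alternating n ℤ.- alternating n
    ≡⟨ ℤ.+-inverseʳ (alternating n) ⟩
  0ℤ ∎

-- Each cyclotomic factor takes the value (-1)^(2^i) + 1 = 2 at x = 0. The evaluation is carried out
-- by letting the product act on the impulse.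
coeff-B-0 : ∀ {m q w} → Binary m q w → coeff (B q m) 0 ≡ + (2 ^ w)
coeff-B-0 {m} {q} {w} b = begin
  coeff (B q m) 0                     ≡⟨ ℤ.*-identityʳ _ ⟨
  coeff (B q m) 0 ℤ.* 1ℤ              ≡⟨ act-impulse (B q m) T-alternating ⟨
  act (B q m) (T alternating) 0       ≡⟨ act-B-periodic alternating (λ j → ℤ.neg-involutive _) b 0 ⟩
  + (2 ^ w) ℤ.* 1ℤ                    ≡⟨ ℤ.*-identityʳ _ ⟩
  + (2 ^ w) ∎

-- Annihilators of `H k` and `S k` for k = 2 q + c

module _ {m q w : ℕ} (c : ℕ) (c≤1 : c ≤ 1) (b : Binary m q w) where

  private
    k : ℕ
    k = 2 * q + c

  act-S : ∀ p n → act p (shift (S k)) n ≡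
    act p (shift (H 0)) n ℤ.+ - (+ 2) ℤ.* act p (shift (H k)) n
  act-S p n = begin
    act p (shift (S k)) n
      ≡⟨ act-cong p (λ j → S-H k (suc j)) n ⟩
    act p (λ j → H 0 (suc j) ℤ.+ - (+ 2) ℤ.* H k (suc j)) n
      ≡⟨ act-+ p (shift (H 0)) _ n ⟩
    act p (shift (H 0)) n ℤ.+ act p (λ j → - (+ 2) ℤ.* H k (suc j)) n
      ≡⟨ cong (ℤ._+_ (act p (shift (H 0)) n)) (act-scale p (- (+ 2)) (shift (H k)) n) ⟩
    act p (shift (H 0)) n ℤ.+ - (+ 2) ℤ.* act p (shift (H k)) n ∎

  act-B-S : ∀ n → act (B q m) (shift (S k)) n ≡ K w c ℤ.* H 0 n
  act-B-S n
    rewrite act-S (B q m) n | act-shift (B q m) (H 0) n | act-shift (B q m) (H k) n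
          | act-B-periodic (h 0) (λ _ → refl) b (suc n) | act-B-H c c≤1 b (suc n)
          | H-suc c n c≤1 =
    lemma (+ (2 ^ w)) (+ 2 ℤ.- + c) (H 0 n)
    where
    lemma : ∀ u v x →
      u ℤ.* (x ℤ.+ x) ℤ.+ - (+ 2) ℤ.* (v ℤ.* x) ≡ + 2 ℤ.* (u ℤ.- v) ℤ.* x
    lemma = solve-∀

  -- For even k, where `triangular` falls one degree short, p is a multiple of (x - 2) B,
  -- whose constant coefficient does not vanish.
  annihilator-H : ∀ p → coeff p 0 ≡ 0ℤ → DegreeBelow (2 + 2 * q) p →
    (∀ n → act p (H k) n ≡ 0ℤ) → ∀ i → coeff p i ≡ 0ℤ
  annihilator-H p p0 deg kills = go c c≤1 refl
    where
    tri : DegreeBelow (suc k) p → ∀ i → coeff p i ≡ 0ℤ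
    tri deg′ = triangular p k (H k) deg′ (H-below k) (H-diagonal k) (λ n _ → kills n)
    go : ∀ c′ → c′ ≤ 1 → c ≡ c′ → ∀ i → coeff p i ≡ 0ℤ
    -- For odd k the bound 2 + 2 q is exactly k + 1, which is what `triangular` requires.
    go (suc zero) _ refl = tri λ i k<i → deg i (subst (_≤ i) (cong suc (ℕ.+-comm (2 * q) 1)) k<i)
    go (suc (suc _)) (s≤s ())
    go zero _ refl = tri deg′
      where
      M V : Poly
      M = mulP Xm2 (B q m)
      a : ℤ
      a = coeff p (suc k)
      -- Subtracting a M cancels the coefficient of degree k + 1, so `triangular` gives V = 0;
      -- comparing constant coefficients then forces a = 0.
      V = addP p (scaleP (- a) M)
      coeff-V : ∀ i → coeff V i ≡ coeff p i ℤ.+ - a ℤ.* coeff M i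
      coeff-V i = trans (coeff-addP p _ i) (cong (ℤ._+_ (coeff p i)) (coeff-scaleP (- a) M i))
      monic-M : Monic (suc k) M
      monic-M = subst (λ d → Monic (suc d) M) (sym (ℕ.+-identityʳ (2 * q)))
                  (monic-mulP 1 Xm2 (2 * q) (B q m) (monic-linear _) (monic-B b))
      deg-p : DegreeBelow (2 + k) p
      deg-p i = subst (λ d → 2 + d ≤ i → coeff p i ≡ 0ℤ) (sym (ℕ.+-identityʳ (2 * q))) (deg i)
      deg-V : DegreeBelow (suc k) V
      deg-V i k<i with ℕ.m≤n⇒m<n∨m≡n k<i
      ... | inj₁ 1+k<i rewrite coeff-V i | deg-p i 1+k<i | proj₂ monic-M i 1+k<i | ℤ.*-zeroʳ (- a) = refl
      ... | inj₂ refl rewrite coeff-V (suc k) | proj₁ monic-M | ℤ.*-identityʳ (- a) = ℤ.+-inverseʳ a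
      kills-M : ∀ n → act M (H k) n ≡ 0ℤ
      kills-M n = trans (act-mulP Xm2 (B q m) (H k) n)
        (trans (act-cong Xm2 (act-B-H 0 z≤n b) n) (act-Xm2-H0 n))
      kills-V : ∀ n → act V (H k) n ≡ 0ℤ
      kills-V n rewrite act-addP p (scaleP (- a) M) (H k) n | act-scaleP (- a) M (H k) n
                      | kills n | kills-M n | ℤ.*-zeroʳ (- a) = refl
      V≈0 : ∀ i → coeff V i ≡ 0ℤ
      V≈0 = triangular V k (H k) deg-V (H-below k) (H-diagonal k) (λ n _ → kills-V n)
      coeff-M-0 : coeff M 0 ≡ - (+ 2) ℤ.* + (2 ^ w)
      coeff-M-0 rewrite coeff-mulP-∷ (- (+ 2)) (1ℤ ∷ []) (B q m) 0 | coeff-B-0 b = ℤ.+-identityʳ _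
      a*2^w≡0 : + 2 ℤ.* (a ℤ.* + (2 ^ w)) ≡ 0ℤ
      a*2^w≡0 = begin
        + 2 ℤ.* (a ℤ.* + (2 ^ w))                       ≡⟨ lemma a (+ (2 ^ w)) ⟩
        0ℤ ℤ.+ - a ℤ.* (- (+ 2) ℤ.* + (2 ^ w))          ≡⟨ cong₂ (λ x y → x ℤ.+ - a ℤ.* y) p0 coeff-M-0 ⟨
        coeff p 0 ℤ.+ - a ℤ.* coeff M 0                 ≡⟨ coeff-V 0 ⟨
        coeff V 0                                       ≡⟨ V≈0 0 ⟩
        0ℤ ∎
        where
        lemma : ∀ a x → + 2 ℤ.* (a ℤ.* x) ≡ 0ℤ ℤ.+ - a ℤ.* (- (+ 2) ℤ.* x)
        lemma = solve-∀
      a≡0 : a ≡ 0ℤ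
      a≡0 with ℤ.i*j≡0⇒i≡0∨j≡0 a (2*-cancel _ a*2^w≡0)
      ... | inj₁ eq = eq
      ... | inj₂ eq = ⊥-elim (ℕ.<⇒≢ (ℕ.m^n>0 2 w) (sym (ℤ.+-injective eq)))
      deg′ : DegreeBelow (suc k) p
      deg′ i k<i with ℕ.m≤n⇒m<n∨m≡n k<i
      ... | inj₁ 1+k<i = deg-p i 1+k<i
      ... | inj₂ refl  = a≡0

  -- Let r send 2^(n+1) to X and H k (n+1) to Y. Annihilation means X = 2 Y, and X doubles at each
  -- step, so Y does as well. Hence x (x - 2) r annihilates `H k`, and its degree is below 2 q + 2.
  annihilator-S-2q : ∀ r → DegreeBelow (2 * q) r →
    (∀ n → act r (shift (S k)) n ≡ 0ℤ) → ∀ i → coeff r i ≡ 0ℤ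
  annihilator-S-2q r deg kills = r≈0
    where
    p : Poly
    p = addP (0ℤ ∷ r) (scaleP (- (+ 2)) r)
    coeff-p : ∀ i → coeff p i ≡ coeff (0ℤ ∷ r) i ℤ.+ - (+ 2) ℤ.* coeff r i
    coeff-p i = trans (coeff-addP (0ℤ ∷ r) (scaleP (- (+ 2)) r) i) (cong (ℤ._+_ (coeff (0ℤ ∷ r) i)) (coeff-scaleP (- (+ 2)) r i))
    deg-p : DegreeBelow (2 + 2 * q) (0ℤ ∷ p)
    deg-p (suc (suc i)) (s≤s (s≤s d≤i))
      rewrite coeff-p (suc i) | deg i d≤i | deg (suc i) (ℕ.m≤n⇒m≤1+n d≤i) = refl
    X Y : ℕ → ℤ
    X = act r (shift (H 0))
    Y = act r (shift (H k))
    X-suc : ∀ n → X (suc n) ≡ + 2 ℤ.* X n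
    X-suc n = begin
      act r (shift (H 0)) (suc n)       ≡⟨ act-shift r (shift (H 0)) n ⟨
      act r (shift (shift (H 0))) n     ≡⟨ act-cong r (λ j → H-suc 0 (suc j) z≤n) n ⟩
      act r (λ j → + 2 ℤ.* H 0 (suc j)) n ≡⟨ act-scale r (+ 2) (shift (H 0)) n ⟩
      + 2 ℤ.* X n ∎
    X-2Y : ∀ n → X n ℤ.+ - (+ 2) ℤ.* Y n ≡ 0ℤ
    X-2Y n = trans (sym (act-S r n)) (kills n)
    Y-suc : ∀ n → Y (suc n) ℤ.+ - (+ 2) ℤ.* Y n ≡ 0ℤ
    Y-suc n = 2*-cancel _ (begin
      + 2 ℤ.* (Y (suc n) ℤ.+ - (+ 2) ℤ.* Y n)
        ≡⟨ lemma (X n) (Y n) (Y (suc n)) ⟩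
      - (+ 2 ℤ.* X n ℤ.+ - (+ 2) ℤ.* Y (suc n)) ℤ.+ + 2 ℤ.* (X n ℤ.+ - (+ 2) ℤ.* Y n)
        ≡⟨ cong₂ (λ u v → - u ℤ.+ + 2 ℤ.* v) (trans (cong (ℤ._+ - (+ 2) ℤ.* Y (suc n)) (sym (X-suc n))) (X-2Y (suc n))) (X-2Y n) ⟩
      0ℤ ∎)
      where
      lemma : ∀ x y z → + 2 ℤ.* (z ℤ.+ - (+ 2) ℤ.* y) ≡
        - (+ 2 ℤ.* x ℤ.+ - (+ 2) ℤ.* z) ℤ.+ + 2 ℤ.* (x ℤ.+ - (+ 2) ℤ.* y)
      lemma = solve-∀
    kills-p : ∀ n → act (0ℤ ∷ p) (H k) n ≡ 0ℤ
    kills-p n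
      rewrite act-0∷ p (H k) n | act-addP (0ℤ ∷ r) (scaleP (- (+ 2)) r) (H k) (suc n)
            | act-0∷ r (H k) (suc n) | act-scaleP (- (+ 2)) r (H k) (suc n)
            | sym (act-shift r (H k) (suc n)) | sym (act-shift r (H k) n) = Y-suc n
    p≈0 : ∀ i → coeff p i ≡ 0ℤ
    p≈0 i = annihilator-H (0ℤ ∷ p) refl deg-p kills-p (suc i)
    cancel : ∀ x y → x ≡ 0ℤ → x ℤ.+ - (+ 2) ℤ.* y ≡ 0ℤ → y ≡ 0ℤ
    cancel x y refl eq = 2*-cancel y (sym (ℤ.i-j≡0⇒i≡j 0ℤ (+ 2 ℤ.* y) (trans (lemma y) eq)))
      where
      lemma : ∀ y → 0ℤ ℤ.- + 2 ℤ.* y ≡ 0ℤ ℤ.+ - (+ 2) ℤ.* y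
      lemma = solve-∀
    -- The coefficients of (x - 2) r are r_(i-1) - 2 r_i, so they determine r from the constant term
    -- upwards.
    r≈0 : ∀ i → coeff r i ≡ 0ℤ
    r≈0 zero    = cancel 0ℤ _ refl (trans (sym (coeff-p 0)) (p≈0 0))
    r≈0 (suc i) = cancel _ _ (r≈0 i) (trans (sym (coeff-p (suc i))) (p≈0 (suc i)))

  -- As act-comm lets r pass B, it annihilates K 2 ^ n as well.
  annihilator-S-1+2q : 2 ≤ w + c → ∀ r → DegreeBelow (suc (2 * q)) r →
    (∀ n → act r (shift (S k)) n ≡ 0ℤ) → ∀ i → coeff r i ≡ 0ℤ
  annihilator-S-1+2q 2≤w+c r deg kills i = annihilator-H (0ℤ ∷ r) refl deg′ kills′ (suc i)
    where
    deg′ : DegreeBelow (2 + 2 * q) (0ℤ ∷ r)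
    deg′ (suc i) (s≤s d≤i) = deg i d≤i
    K*≡0 : ∀ n → K w c ℤ.* act r (H 0) n ≡ 0ℤ
    K*≡0 n = begin
      K w c ℤ.* act r (H 0) n                ≡⟨ act-scale r (K w c) (H 0) n ⟨
      act r (λ j → K w c ℤ.* H 0 j) n        ≡⟨ act-cong r act-B-S n ⟨
      act r (act (B q m) (shift (S k))) n    ≡⟨ act-comm r (B q m) (shift (S k)) n ⟩
      act (B q m) (act r (shift (S k))) n    ≡⟨ act-zero (B q m) kills n ⟩
      0ℤ ∎
    kills-2^ : ∀ n → act r (H 0) n ≡ 0ℤ
    kills-2^ n with ℤ.i*j≡0⇒i≡0∨j≡0 (K w c) (K*≡0 n)
    ... | inj₁ K≡0 = ⊥-elim (K≢0 w c c≤1 2≤w+c K≡0)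
    ... | inj₂ eq  = eq
    -- Once r annihilates 2^n, the relation for `S k` reduces to -2 Y = 0.
    kills′ : ∀ n → act (0ℤ ∷ r) (H k) n ≡ 0ℤ
    kills′ n = trans (act-0∷ r (H k) n) (trans (sym (act-shift r (H k) n)) (2*-cancel _
      (begin
        + 2 ℤ.* Y                   ≡⟨ lemma Y ⟩
        - (0ℤ ℤ.+ - (+ 2) ℤ.* Y)    ≡⟨ cong (λ x → - (x ℤ.+ - (+ 2) ℤ.* Y)) (trans (act-shift r (H 0) n) (kills-2^ (suc n))) ⟨
        - (act r (shift (H 0)) n ℤ.+ - (+ 2) ℤ.* Y) ≡⟨ cong -_ (trans (sym (act-S r n)) (kills n)) ⟩
        0ℤ ∎)))
      where
      Y : ℤ
      Y = act r (shift (H k)) n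
      lemma : ∀ y → + 2 ℤ.* y ≡ - (0ℤ ℤ.+ - (+ 2) ℤ.* y)
      lemma = solve-∀

-- Assembling the theorem from the digits of k / 2

n<2^n : ∀ n → n < 2 ^ n
n<2^n zero    = s≤s z≤n
n<2^n (suc n) rewrite 2^suc n = ℕ.+-mono-≤ (ℕ.m^n>0 2 n) (n<2^n n)

monic-Ppoly : ∀ k e → ∀ {w} → Binary (kbar k) (k / 2) w → Monic (2 * (k / 2) + e) (Ppoly k e)
monic-Ppoly k e b = subst (λ d → Monic d (Ppoly k e)) (ℕ.+-comm e (2 * (k / 2)))
  (monic-mulP e (powP Xm2 e) (2 * (k / 2)) (B (k / 2) (kbar k)) (monic-powP Xm2 (monic-linear _) e) (monic-B b))

mainTheorem3 : (k : ℕ) → 1 ≤ k → (e : ℕ) → Eps k e →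
    (Σ ℕ λ D → Σ (Fin D → ℤ) λ a → MinimalRec (S k) D a × charPoly D a ≈P Ppoly k e)
    × (∀ D (a : Fin D → ℤ) → MinimalRec (S k) D a →
    (charPoly D a ≈P Ppoly k e) × (D ≡ 2 * (k / 2) + e))
mainTheorem3 k 1≤k e eps =
  minimalRec-charPoly (S k) (2 * q + e) (Ppoly k e) (monic-Ppoly k e b) (kills e eps) (least e eps)
  where
  q c m w : ℕ
  q = k / 2
  c = k % 2
  m = kbar k
  k≡ : k ≡ 2 * q + c
  k≡ = trans (m≡m%n+[m/n]*n k 2) (trans (ℕ.+-comm c (q * 2)) (cong (_+ c) (ℕ.*-comm q 2)))
  c≤1 : c ≤ 1
  c≤1 = ℕ.≤-pred (m%n<n k 2)
  q≤m : q ≤ m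
  q≤m = ℕ.≤-trans (ℕ.m≤m+n q (q + 0)) (ℕ.m≤m+n (2 * q) 1)
  expansion : ∃ λ w → Binary m q w
  -- `Ppoly` takes its product up to `kbar k`, so q is expanded with that many digits; the leading
  -- zeros contribute factors 1.
  expansion = binary m q (ℕ.≤-<-trans q≤m (n<2^n m))
  w = proj₁ expansion
  b : Binary m q w
  b = proj₂ expansion

  act-P : ∀ e n → act (Ppoly k e) (shift (S k)) n ≡ act (powP Xm2 e) (λ j → K w c ℤ.* H 0 j) n
  act-P e n = trans (act-mulP (powP Xm2 e) (B q m) (shift (S k)) n)
    (act-cong (powP Xm2 e) (λ j → trans (cong (λ k → act (B q m) (shift (S k)) j) k≡) (act-B-S c c≤1 b j)) n)

  kills : ∀ e → Eps k e → ∀ n → act (Ppoly k e) (shift (S k)) n ≡ 0ℤ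
  -- For a power of two the product alone suffices because `K` vanishes; otherwise x - 2 removes the
  -- remaining multiple of 2^n.
  kills _ (pow2 a k≡2^a) n = trans (act-P 0 n) (act-zero (powP Xm2 0) (λ j →
    cong (ℤ._* H 0 j) (K≡0 w c (weight-2^ c a c≤1 b (trans (sym k≡) k≡2^a)))) n)
  kills _ (notPow2 not2^) n = begin
    act (Ppoly k 1) (shift (S k)) n                         ≡⟨ act-P 1 n ⟩
    act (mulP Xm2 (1ℤ ∷ [])) (λ j → K w c ℤ.* H 0 j) n      ≡⟨ act-scale (mulP Xm2 (1ℤ ∷ [])) (K w c) (H 0) n ⟩
    K w c ℤ.* act (mulP Xm2 (1ℤ ∷ [])) (H 0) n
      ≡⟨ cong (ℤ._*_ (K w c)) (act-mulP Xm2 (1ℤ ∷ []) (H 0) n) ⟩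
    K w c ℤ.* act Xm2 (act (1ℤ ∷ []) (H 0)) n
      ≡⟨ cong (ℤ._*_ (K w c)) (trans (act-cong Xm2 (act-1 (H 0)) n) (act-Xm2-H0 n)) ⟩
    K w c ℤ.* 0ℤ                                            ≡⟨ ℤ.*-zeroʳ (K w c) ⟩
    0ℤ ∎

  least : ∀ e → Eps k e → ∀ r → DegreeBelow (2 * q + e) r →
    (∀ n → act r (shift (S k)) n ≡ 0ℤ) → ∀ i → coeff r i ≡ 0ℤ
  least _ (pow2 a k≡2^a) r deg kills = annihilator-S-2q c c≤1 b r
    (subst (λ d → DegreeBelow d r) (ℕ.+-identityʳ (2 * q)) deg)
    (λ n → trans (cong (λ k → act r (shift (S k)) n) (sym k≡)) (kills n))
  -- A positive k that is not a power of two has at least two binary ones, so `K` is nonzero.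
  least _ (notPow2 not2^) r deg kills = annihilator-S-1+2q c c≤1 b
    (weight-not2^ c c≤1 b (subst (1 ≤_) k≡ 1≤k) (λ a eq → not2^ a (trans k≡ eq))) r
    (subst (λ d → DegreeBelow d r) (ℕ.+-comm (2 * q) 1) deg)
    (λ n → trans (cong (λ k → act r (shift (S k)) n) (sym k≡)) (kills n))
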